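{- Let $p\ge2$ be an integer, $\pi$ a $p$-adic permutation, $k\ge0$ an integer, and let $S=([a_0],\dots,[a_{r-1}])$ be (a representative of) a cycle of length $r$ of $\pi_k$. Then there are $m\in\{1,\dots,p\}$, positive integers $s_0,\dots,s_{m-1}$ with $s_n/r\in\{1,\dots,p\}$ (in particular $r\mid s_n$) for all $n\in\{0,\dots,m-1\}$ and $\sum_{n=0}^{m-1}s_n/r=p$, and $m$ pairwise distinct cycles of $\pi_{k+1}$ (the children of $S$), represented by $$([b_{0,0}],\dots,[b_{0,s_0-1}]),\ \dots,\ ([b_{m-1,0}],\dots,[b_{m-1,s_{m-1}-1}]),$$ such that $$a_i\equiv b_{n,jr+i}\pmod{p^k}\quad\text{for all } n\in\{0,\dots,m-1\},\ i\in\{0,\dots,r-1\},\ j\in\{0,\dots,s_n/r-1\}.$$ In particular, the set of cycles of $\pi_{k+1}$ is the disjoint union of the sets of children of all cycles of $\pi_k$.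
   Context: $p\ge2$ is an integer, not necessarily prime, and $\mathbb{Z}_p=\varprojlim \mathbb{Z}/p^k\mathbb{Z}$. A $p$-adic permutation is a permutation $\pi$ of $\mathbb{Z}_p$ such that $\pi(n)\equiv n\pmod p$ for all $n\in\mathbb{Z}_p$, and for all integers $k\ge1$ and all $m,n\in\mathbb{Z}_p$: $m\equiv n\pmod{p^k}\Leftrightarrow\pi(m)\equiv\pi(n)\pmod{p^k}$. For $k\ge0$ it induces the permutation $\pi_k$ of $\mathbb{Z}_p/p^k\mathbb{Z}_p$, $[n]\mapsto[\pi(n)]$. Cycles of a permutation of a finite set (including fixed points, which are cycles of length $1$) are regarded as finite sequences of distinct elements, each entry being mapped to the cyclically next one, up to cyclic shift. -}

module Defs where

open import Algebra.Bundles using (CommutativeRing)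
import Algebra.Definitions.RawMagma as Divisibility
import Algebra.Properties.AbelianGroup as AbelianGroupProperties
import Algebra.Properties.Ring as RingProperties
open import Data.Fin.Base using (Fin; toℕ; cast; combine)
import Data.Integer.Base as ℤ
open ℤ using (ℤ; +_)
import Data.Integer.Properties as ℤ
open import Data.Nat.Base using (ℕ; suc; _+_; _^_; _≤_; NonZero; s≤s; z≤n)
open import Data.Nat.Divisibility using (module _∣_) renaming (_∣_ to _∣ℕ_)
open import Data.Nat.DivMod using (_mod_)
import Data.Nat.Properties as ℕ
open import Algebra.Properties.CommutativeMonoid.Sum ℕ.+-0-commutativeMonoid using (sum)
open import Data.Product.Base using (Σ-syntax; ∃-syntax; _,_)
open import Function.Bundles using (Bijection; _⇔_; Equivalence)
open import Function.Definitions using (Injective)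
open import Level using (Level; 0ℓ; _⊔_)
open import Relation.Binary.Bundles using (Setoid)
open import Relation.Binary.PropositionalEquality.Core using (_≡_; sym)
import Relation.Binary.Reasoning.Setoid as SetoidReasoning

private
  variable
    c ℓ : Level

module _ (R : CommutativeRing c ℓ) (n : CommutativeRing.Carrier R) where
  open CommutativeRing R renaming (_+_ to _⊕_; refl to ≈-refl; sym to ≈-sym)
  open Divisibility *-rawMagma using (_∣_; _,_)
  open AbelianGroupProperties +-abelianGroup
    using (x≈y⇒x∙y⁻¹≈ε; ⁻¹-anti-homo‿-; //-rightDividesˡ; //-rightDividesʳ)
  open RingProperties ring using (-‿distribˡ-*)
  open SetoidReasoning setoid

  -- A record rather than a synonym so that x and y can be inferred.
  record Congruent (x y : Carrier) : Set (c ⊔ ℓ) where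
    constructor congruent
    field
      divides : n ∣ x - y

  private
    _≋_ : Carrier → Carrier → Set (c ⊔ ℓ)
    _≋_ = Congruent

    to-sum : ∀ {x y q} → q * n ≈ x - y → q * n ⊕ y ≈ x
    to-sum {x} {y} e = trans (+-congʳ e) (//-rightDividesˡ y x)

    from-sum : ∀ {x y} q → q * n ⊕ y ≈ x → x ≋ y
    from-sum {x} {y} q e =
      congruent (q , trans (≈-sym (//-rightDividesʳ y (q * n))) (+-congʳ e))

    ≋-reflexive : ∀ {x y} → x ≈ y → x ≋ y
    ≋-reflexive e = congruent (0# , trans (zeroˡ n) (≈-sym (x≈y⇒x∙y⁻¹≈ε e)))

    ≋-sym : ∀ {x y} → x ≋ y → y ≋ x
    ≋-sym {x} {y} (congruent (q , e)) = congruent ((- q) , (begin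
      - q * n      ≈⟨ ≈-sym (-‿distribˡ-* q n) ⟩
      - (q * n)    ≈⟨ -‿cong e ⟩
      - (x - y)    ≈⟨ ⁻¹-anti-homo‿- x y ⟩
      y - x        ∎))

    ≋-trans : ∀ {x y z} → x ≋ y → y ≋ z → x ≋ z
    ≋-trans {x} {y} {z} (congruent (q , e)) (congruent (r , f)) = from-sum (q ⊕ r) (begin
      (q ⊕ r) * n ⊕ z        ≈⟨ +-congʳ (distribʳ n q r) ⟩
      (q * n ⊕ r * n) ⊕ z    ≈⟨ +-assoc _ _ _ ⟩
      q * n ⊕ (r * n ⊕ z)    ≈⟨ +-congˡ (to-sum f) ⟩
      q * n ⊕ y              ≈⟨ to-sum e ⟩
      x                      ∎)

    +-congʳ-≋ : ∀ {x y} z → x ≋ y → (x ⊕ z) ≋ (y ⊕ z)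
    +-congʳ-≋ {x} {y} z (congruent (q , e)) = from-sum q (begin
      q * n ⊕ (y ⊕ z)    ≈⟨ ≈-sym (+-assoc _ _ _) ⟩
      (q * n ⊕ y) ⊕ z    ≈⟨ +-congʳ (to-sum e) ⟩
      x ⊕ z              ∎)

    *-congˡ-≋ : ∀ {x y} z → x ≋ y → (z * x) ≋ (z * y)
    *-congˡ-≋ {x} {y} z (congruent (q , e)) = from-sum (z * q) (begin
      (z * q) * n ⊕ z * y    ≈⟨ +-congʳ (*-assoc z q n) ⟩
      z * (q * n) ⊕ z * y    ≈⟨ ≈-sym (distribˡ z (q * n) y) ⟩
      z * (q * n ⊕ y)        ≈⟨ *-congˡ (to-sum e) ⟩
      z * x                  ∎)

    +-cong-≋ : ∀ {x y u v} → x ≋ y → u ≋ v → (x ⊕ u) ≋ (y ⊕ v)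
    +-cong-≋ {x} {y} {u} {v} e f = ≋-trans (+-congʳ-≋ u e)
      (≋-trans (≋-reflexive (+-comm y u))
      (≋-trans (+-congʳ-≋ y f) (≋-reflexive (+-comm v y))))

    *-cong-≋ : ∀ {x y u v} → x ≋ y → u ≋ v → (x * u) ≋ (y * v)
    *-cong-≋ {x} {y} {u} {v} e f = ≋-trans (≋-reflexive (*-comm x u))
      (≋-trans (*-congˡ-≋ u e)
      (≋-trans (≋-reflexive (*-comm u y)) (*-congˡ-≋ y f)))

    neg-cong-≋ : ∀ {x y} → x ≋ y → (- x) ≋ (- y)
    neg-cong-≋ {x} {y} (congruent (q , e)) = from-sum (- q) (begin
      - q * n ⊕ - y          ≈⟨ +-congʳ (≈-sym (-‿distribˡ-* q n)) ⟩
      - (q * n) ⊕ - y        ≈⟨ +-congʳ (-‿cong e) ⟩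
      - (x - y) ⊕ - y        ≈⟨ +-congʳ (⁻¹-anti-homo‿- x y) ⟩
      (y - x) ⊕ - y          ≈⟨ +-congʳ (+-comm y (- x)) ⟩
      (- x ⊕ y) ⊕ - y        ≈⟨ //-rightDividesʳ y (- x) ⟩
      - x                    ∎)

  -- The quotient ring R / nR: same carrier and operations, coarser equality.
  quotientRing : CommutativeRing c (c ⊔ ℓ)
  quotientRing = record
    { Carrier = Carrier ; _≈_ = Congruent
    ; _+_ = _⊕_ ; _*_ = _*_ ; -_ = -_ ; 0# = 0# ; 1# = 1#
    ; isCommutativeRing = record
      { isRing = record
        { +-isAbelianGroup = record
          { isGroup = record
            { isMonoid = record
              { isSemigroup = record
                { isMagma = record
                  { isEquivalence = record
                    { refl = ≋-reflexive ≈-refl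
                    ; sym = ≋-sym
                    ; trans = ≋-trans
                    }
                  ; ∙-cong = +-cong-≋
                  }
                ; assoc = λ x y z → ≋-reflexive (+-assoc x y z)
                }
              ; identity = (λ x → ≋-reflexive (+-identityˡ x))
                         , (λ x → ≋-reflexive (+-identityʳ x))
              }
            ; inverse = (λ x → ≋-reflexive (-‿inverseˡ x))
                      , (λ x → ≋-reflexive (-‿inverseʳ x))
            ; ⁻¹-cong = neg-cong-≋
            }
          ; comm = λ x y → ≋-reflexive (+-comm x y)
          }
        ; *-cong = *-cong-≋
        ; *-assoc = λ x y z → ≋-reflexive (*-assoc x y z)
        ; *-identity = (λ x → ≋-reflexive (*-identityˡ x))
                     , (λ x → ≋-reflexive (*-identityʳ x))
        ; distrib = (λ x y z → ≋-reflexive (distribˡ x y z))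
                  , (λ x y z → ≋-reflexive (distribʳ x y z))
        }
      ; *-comm = λ x y → ≋-reflexive (*-comm x y)
      }
    }

ℤ/_ : ℕ → CommutativeRing 0ℓ 0ℓ
ℤ/ n = quotientRing ℤ.+-*-commutativeRing (+ n)

module _ (p : ℕ) where

  private
    module ℤ/p^ (k : ℕ) = CommutativeRing (ℤ/ (p ^ k))

  -- A point of lim ℤ/p^k, each component being given by an integer
  -- representative; the transition maps are induced by the identity of ℤ.
  record PAdic : Set where
    field
      component : ℕ → ℤ
      coherent  : ∀ k → ℤ/p^._≈_ k (component (suc k)) (component k)

  open PAdic

  infix 4 _≈ₚ_
  record _≈ₚ_ (x y : PAdic) : Set where
    constructor componentwise
    field
      at : ∀ k → ℤ/p^._≈_ k (component x k) (component y k)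

  open _≈ₚ_

  fromℤ : ℤ → PAdic
  fromℤ z = record { component = λ _ → z ; coherent = λ k → ℤ/p^.refl k }

  ℤₚ : CommutativeRing 0ℓ 0ℓ
  ℤₚ = record
    { Carrier = PAdic
    ; _≈_ = _≈ₚ_
    ; _+_ = λ x y → record
      { component = λ k → component x k ℤ.+ component y k
      ; coherent  = λ k → ℤ/p^.+-cong k (coherent x k) (coherent y k)
      }
    ; _*_ = λ x y → record
      { component = λ k → component x k ℤ.* component y k
      ; coherent  = λ k → ℤ/p^.*-cong k (coherent x k) (coherent y k)
      }
    ; -_ = λ x → record
      { component = λ k → ℤ.- component x k
      ; coherent  = λ k → ℤ/p^.-‿cong k (coherent x k)
      }
    ; 0# = fromℤ ℤ.0ℤ
    ; 1# = fromℤ ℤ.1ℤ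
    ; isCommutativeRing = record
      { isRing = record
        { +-isAbelianGroup = record
          { isGroup = record
            { isMonoid = record
              { isSemigroup = record
                { isMagma = record
                  { isEquivalence = record
                    { refl  = componentwise (λ k → ℤ/p^.refl k)
                    ; sym   = λ e → componentwise (λ k → ℤ/p^.sym k (at e k))
                    ; trans = λ e f → componentwise (λ k → ℤ/p^.trans k (at e k) (at f k))
                    }
                  ; ∙-cong = λ e f → componentwise (λ k → ℤ/p^.+-cong k (at e k) (at f k))
                  }
                ; assoc = λ x y z →
                      componentwise (λ k → ℤ/p^.+-assoc k (component x k) (component y k) (component z k))
                }
              ; identity = (λ x → componentwise (λ k → ℤ/p^.+-identityˡ k (component x k)))
                         , (λ x → componentwise (λ k → ℤ/p^.+-identityʳ k (component x k)))
              }
            ; inverse = (λ x → componentwise (λ k → ℤ/p^.-‿inverseˡ k (component x k)))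
                      , (λ x → componentwise (λ k → ℤ/p^.-‿inverseʳ k (component x k)))
            ; ⁻¹-cong = λ e → componentwise (λ k → ℤ/p^.-‿cong k (at e k))
            }
          ; comm = λ x y →
                componentwise (λ k → ℤ/p^.+-comm k (component x k) (component y k))
          }
        ; *-cong = λ e f → componentwise (λ k → ℤ/p^.*-cong k (at e k) (at f k))
        ; *-assoc = λ x y z →
              componentwise (λ k → ℤ/p^.*-assoc k (component x k) (component y k) (component z k))
        ; *-identity = (λ x → componentwise (λ k → ℤ/p^.*-identityˡ k (component x k)))
                     , (λ x → componentwise (λ k → ℤ/p^.*-identityʳ k (component x k)))
        ; distrib = (λ x y z →
              componentwise (λ k → ℤ/p^.distribˡ k (component x k) (component y k) (component z k)))
                  , (λ x y z →
                        componentwise (λ k → ℤ/p^.distribʳ k (component x k) (component y k) (component z k)))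
        }
      ; *-comm = λ x y →
            componentwise (λ k → ℤ/p^.*-comm k (component x k) (component y k))
      }
    }

  ℤₚ/ : ℕ → Setoid 0ℓ 0ℓ
  ℤₚ/ n = CommutativeRing.setoid (quotientRing ℤₚ (fromℤ (+ n)))

infix 4 _≡_[mod_]
_≡_[mod_] : {p : ℕ} → PAdic p → PAdic p → ℕ → Set
_≡_[mod_] {p} x y n = Setoid._≈_ (ℤₚ/ p n) x y

record PAdicPermutation (p : ℕ) : Set where
  field
    permutation : Bijection (CommutativeRing.setoid (ℤₚ p)) (CommutativeRing.setoid (ℤₚ p))

  open Bijection permutation public using (to)

  field
    to-≡-mod-p   : ∀ n → to n ≡ n [mod p ]
    ≡-mod-p^k-to : ∀ k → 1 ≤ k → ∀ m n →
                   (m ≡ n [mod p ^ k ]) ⇔ (to m ≡ to n [mod p ^ k ])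

module _ {p : ℕ} (π : PAdicPermutation p) where
  open PAdicPermutation π

  private
    module ℤₚ = CommutativeRing (ℤₚ p)

    ≈⇒≡mod : ∀ {x y} n → x ℤₚ.≈ y → x ≡ y [mod n ]
    ≈⇒≡mod n e = congruent
      (Divisibility._,_ ℤₚ.0# (ℤₚ.trans (ℤₚ.zeroˡ (fromℤ p (+ n))) (ℤₚ.sym (x≈y⇒x∙y⁻¹≈ε e))))
      where open AbelianGroupProperties ℤₚ.+-abelianGroup using (x≈y⇒x∙y⁻¹≈ε)

    ≡mod1 : ∀ x y → x ≡ y [mod 1 ]
    ≡mod1 x y = congruent (Divisibility._,_ (x ℤₚ.- y) (ℤₚ.*-identityʳ _))

    to-cong : ∀ k {x y} → x ≡ y [mod p ^ k ] → to x ≡ to y [mod p ^ k ]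
    to-cong 0       {x} {y} _ = ≡mod1 (to x) (to y)
    to-cong (suc k) {x} {y}   = Equivalence.to (≡-mod-p^k-to (suc k) (s≤s z≤n) x y)

    to-injective : ∀ k {x y} → to x ≡ to y [mod p ^ k ] → x ≡ y [mod p ^ k ]
    to-injective 0       {x} {y} _ = ≡mod1 x y
    to-injective (suc k) {x} {y}   = Equivalence.from (≡-mod-p^k-to (suc k) (s≤s z≤n) x y)

  induced : (k : ℕ) → Bijection (ℤₚ/ p (p ^ k)) (ℤₚ/ p (p ^ k))
  induced k = record
    { to        = to
    ; cong      = to-cong k
    ; bijective = to-injective k , λ y →
        let (x , to-x≈y) = Bijection.strictlySurjective permutation y in
        x , λ z≡x → Setoid.trans (ℤₚ/ p (p ^ k)) (to-cong k z≡x) (≈⇒≡mod (p ^ k) to-x≈y)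
    }

rotate : ∀ {r} .{{_ : NonZero r}} → ℕ → Fin r → Fin r
rotate {r} t i = (toℕ i + t) mod r

module _ {A : Setoid c ℓ} where
  open Setoid A using (Carrier; _≈_)

  -- A sequence representing a cycle; equality of cycles is _∼_, i.e. up to
  -- cyclic shift.
  record Cycle (f : Bijection A A) : Set (c ⊔ ℓ) where
    field
      length         : ℕ
      .{{nonEmpty}}  : NonZero length
      entry          : Fin length → Carrier
      entry-distinct : Injective _≡_ _≈_ entry
      entry-step     : ∀ i → Bijection.to f (entry i) ≈ entry (rotate 1 i)

  open Cycle

  infix 4 _∼_
  _∼_ : {f : Bijection A A} → Cycle f → Cycle f → Set ℓ
  C ∼ D = Σ[ eq ∈ length C ≡ length D ] ∃[ t ]
            ∀ i → entry C i ≈ entry D (rotate t (cast eq i))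

open Cycle

-- T enumerates, without repetition, the children of S. In lifts, the index
-- cast _ (combine j i) has value j r + i, where r = length S.
record AreChildren {p : ℕ} (π : PAdicPermutation p) (k : ℕ) (S : Cycle (induced π k))
                   {m : ℕ} (T : Fin m → Cycle (induced π (suc k))) : Set where
  field
    1≤m      : 1 ≤ m
    m≤p      : m ≤ p
    length∣  : ∀ n → length S ∣ℕ length (T n)

  ratio : Fin m → ℕ
  ratio n = _∣_.quotient (length∣ n)

  field
    1≤ratio  : ∀ n → 1 ≤ ratio n
    ratio≤p  : ∀ n → ratio n ≤ p
    sum≡p    : sum ratio ≡ p
    distinct : Injective _≡_ _∼_ T
    lifts    : ∀ n (i : Fin (length S)) (j : Fin (ratio n)) →
               entry S i
                 ≡ entry (T n) (cast (sym (_∣_.equality (length∣ n))) (combine j i))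
                 [mod p ^ k ]

module Submission where

-- Let S be a cycle of π_k of length r, through a. The r-th iterate of π permutes
-- the p lifts of a modulo p^(k+1), so it induces a permutation of Fin p (the
-- first return map). An orbit of length s of that permutation gives a cycle of
-- π_{k+1} of length s r above S, and these lengths s add up to p because the
-- orbits partition Fin p.
--
-- Conversely, given any list of children of S, their entries above a fixed entry
-- of S are pairwise incongruent modulo p^(k+1), and there are p of them because
-- the ratios add up to p; by the pigeonhole principle they exhaust the lifts.
-- Hence every cycle of π_{k+1} above S shares an entry with a child, and two
-- cycles with a common entry agree up to rotation.

import Algebra.Properties.Ring as RingProperties
import Data.Integer.Base as ℤ
import Data.Integer.DivMod as ℤ
import Data.Integer.Divisibility.Signed as ℤ∣
import Data.Integer.Properties as ℤ
import Data.Nat.Properties as ℕ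
import Relation.Binary.Reasoning.Setoid as SetoidReasoning
open import Algebra.Bundles using (CommutativeRing)
open import Algebra.Definitions.RawMagma using (_,_)
open import Algebra.Properties.CommutativeMonoid.Sum ℕ.+-0-commutativeMonoid using (sum)
open import Algebra.Properties.CommutativeSemigroup ℕ.+-commutativeSemigroup using (x∙yz≈y∙xz)
open import Data.Fin.Base using (Fin; zero; suc; toℕ; cast; combine; fromℕ<; punchOut)
open import Data.Fin.Permutation using (↔⇒≡)
open import Data.Fin.Properties as Fin
  using ( any?; +↔⊎; combine-injectiveˡ; injective⇒≤; nonZeroIndex; pigeonhole
        ; punchOut-injective; toℕ<n; toℕ-cast; toℕ-combine; toℕ-fromℕ<; toℕ-injective)
open import Data.Integer.Base using (ℤ; +_)
open import Data.Integer.Tactic.RingSolver using (solve-∀)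
open import Data.Nat.Base
  using ( ℕ; zero; suc; _+_; _*_; _∸_; _^_; _≤_; _<_; NonZero; z<s
        ; >-nonZero; >-nonZero⁻¹; ≢-nonZero; ≢-nonZero⁻¹)
open import Data.Nat.Divisibility
open import Data.Nat.DivMod
open import Data.Nat.GeneralisedArithmetic using (fold; fold-+)
open import Data.Nat.Induction using (Acc; acc; <-wellFounded)
open import Data.Product.Base using (Σ-syntax; ∃; ∃-syntax; _×_; _,_; proj₁; proj₂)
open import Data.Sum.Base using (inj₁; inj₂)
open import Data.Sum.Function.Propositional using (_⊎-↔_)
open import Function.Base using (_∘_)
open import Function.Bundles
  using (_⇔_; mk⇔; Equivalence; Injection; Bijection; mk⤖; _↔_; mk↔ₛ′)
open import Function.Definitions using (Injective)
open import Function.Properties.Bijection using (⤖⇒↔)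
open import Function.Properties.Inverse using (↔-refl; ↔-trans; ↔⇒↣)
open import Level using (Level)
open import Relation.Binary.Bundles using (Setoid)
open import Relation.Binary.Consequences using (wlog)
open import Relation.Binary.Core using (Rel)
open import Relation.Binary.Definitions using (Decidable; Reflexive; Symmetric)
open import Relation.Binary.PropositionalEquality.Core as ≡ using (_≡_; refl)
open import Relation.Binary.PropositionalEquality.Properties using (module ≡-Reasoning; setoid)
open import Relation.Nullary.Decidable using (Dec; yes; no; map′; ¬?; _×-dec_; decidable-stable)
open import Relation.Nullary.Negation using (contradiction)
open import Defs

private
  variable
    c ℓ : Level

-- Finite sets

-- A missed value `y` could be punched out of the codomain, leaving an injection of `Fin m` into a
-- set with fewer than m elements.
injective⇒surjective : ∀ {m n} {f : Fin m → Fin n} → n ≤ m → Injective _≡_ _≡_ f →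
                       ∀ y → ∃ λ x → f x ≡ y
injective⇒surjective {n = suc n} {f = f} n≤m f-injective y with any? (λ x → f x Fin.≟ y)
... | yes x-y = x-y
... | no ∄x = contradiction
  (ℕ.≤-trans n≤m (injective⇒≤ {f = λ x → punchOut {i = y} (∄x ∘ (x ,_) ∘ ≡.sym)}
    (f-injective ∘ punchOut-injective {i = y} _ _)))
  ℕ.1+n≰n

Fin-sum↔Σ : ∀ {m} (f : Fin m → ℕ) → Fin (sum f) ↔ (Σ[ i ∈ Fin m ] Fin (f i))
Fin-sum↔Σ {zero}  f = mk↔ₛ′ (λ ()) (λ ()) (λ ()) (λ ())
Fin-sum↔Σ {suc m} f = ↔-trans +↔⊎ (↔-trans (↔-refl ⊎-↔ Fin-sum↔Σ (f ∘ suc)) (mk↔ₛ′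
  (λ { (inj₁ j) → zero , j ; (inj₂ (i , j)) → suc i , j })
  (λ { (zero , j) → inj₁ j ; (suc i , j) → inj₂ (i , j) })
  (λ { (zero , j) → refl ; (suc i , j) → refl })
  (λ { (inj₁ j) → refl ; (inj₂ (i , j)) → refl })))

Σ-injective⇒surjective : ∀ {m n} {f : Fin m → ℕ} {g : Σ[ i ∈ Fin m ] Fin (f i) → Fin n} →
                         n ≤ sum f → Injective _≡_ _≡_ g → ∀ y → ∃ λ x → g x ≡ y
Σ-injective⇒surjective {f = f} n≤sum g-injective y
  with x , e ← injective⇒surjective n≤sum (Injection.injective (↔⇒↣ (Fin-sum↔Σ f)) ∘ g-injective) y
  = Injection.to (↔⇒↣ (Fin-sum↔Σ f)) x , e

0<sum⇒0<m : ∀ {m} (f : Fin m → ℕ) → 0 < sum f → 0 < m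
0<sum⇒0<m {suc m} f _ = z<s

f≤sum : ∀ {m} (f : Fin m → ℕ) i → f i ≤ sum f
f≤sum f zero    = ℕ.m≤m+n _ _
f≤sum f (suc i) = ℕ.≤-trans (f≤sum (f ∘ suc) i) (ℕ.m≤n+m _ _)

-- Greedy choice: representatives of the nonzero elements are chosen first, and `zero` is added
-- exactly when none of them is related to it.
transversal : ∀ {n ℓ} {_~_ : Rel (Fin n) ℓ} → Reflexive _~_ → Symmetric _~_ → Decidable _~_ →
              ∃ λ m → Σ[ t ∈ (Fin m → Fin n) ] Injective _≡_ _~_ t × (∀ u → ∃ λ i → t i ~ u)
transversal {zero}  ~-refl ~-sym _~?_ = 0 , (λ ()) , (λ { {()} }) , λ ()
transversal {suc n} {_~_ = _~_} ~-refl ~-sym _~?_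
  with transversal {_~_ = λ i j → suc i ~ suc j} ~-refl ~-sym (λ i j → suc i ~? suc j)
... | m , t , t-injective , t-covers with any? (λ i → suc (t i) ~? zero)
...   | yes covered = m , suc ∘ t , t-injective , λ { zero → covered ; (suc u) → t-covers u }
...   | no uncovered = suc m , t′ , t′-injective , λ
  { zero    → zero , ~-refl
  ; (suc u) → let (i , e) = t-covers u in suc i , e
  }
  where
  t′ : Fin (suc m) → Fin (suc n)
  t′ zero    = zero
  t′ (suc i) = suc (t i)

  t′-injective : Injective _≡_ _~_ t′
  t′-injective {zero}  {zero}  _ = refl
  t′-injective {zero}  {suc j} e = contradiction (j , ~-sym e) uncovered
  t′-injective {suc i} {zero}  e = contradiction (i , e) uncovered
  t′-injective {suc i} {suc j} e = ≡.cong suc (t-injective e)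

-- Rotations

[m%n+k]%n≡[m+k]%n : ∀ m k n .{{_ : NonZero n}} → (m % n + k) % n ≡ (m + k) % n
[m%n+k]%n≡[m+k]%n m k n = begin
  (m % n + k) % n              ≡⟨ %-distribˡ-+ (m % n) k n ⟩
  (m % n % n + k % n) % n      ≡⟨ ≡.cong (λ x → (x + k % n) % n) (m%n%n≡m%n m n) ⟩
  (m % n + k % n) % n          ≡⟨ %-distribˡ-+ m k n ⟨
  (m + k) % n                  ∎
  where open ≡-Reasoning

[m+n]%d≡m%d⇔d∣n : ∀ m n d .{{_ : NonZero d}} → (m + n) % d ≡ m % d ⇔ d ∣ n
[m+n]%d≡m%d⇔d∣n m n d = mk⇔ to from
  where
  open ≡-Reasoning
  to : (m + n) % d ≡ m % d → d ∣ n
  -- Dividing m and m + n by d with equal remainders and cancelling the remainder shows that d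
  -- divides `m / d * d + n`.
  to e = ∣m+n∣m⇒∣n {d} {m / d * d} (divides ((m + n) / d) (ℕ.+-cancelˡ-≡ (m % d) _ _ (begin
    m % d + (m / d * d + n)          ≡⟨ ℕ.+-assoc (m % d) _ n ⟨
    m % d + m / d * d + n            ≡⟨ ≡.cong (_+ n) (m≡m%n+[m/n]*n m d) ⟨
    m + n                            ≡⟨ m≡m%n+[m/n]*n (m + n) d ⟩
    (m + n) % d + (m + n) / d * d    ≡⟨ ≡.cong (_+ (m + n) / d * d) e ⟩
    m % d + (m + n) / d * d          ∎))) (n∣m*n (m / d))

  from : d ∣ n → (m + n) % d ≡ m % d
  from = %-remove-+ʳ m

toℕ-rotate : ∀ {r} .{{_ : NonZero r}} n (i : Fin r) → toℕ (rotate n i) ≡ (toℕ i + n) % r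
toℕ-rotate {r} n i = toℕ-fromℕ< (m%n<n (toℕ i + n) r)

rotate-rotate : ∀ {r} .{{_ : NonZero r}} m n (i : Fin r) →
                rotate m (rotate n i) ≡ rotate (n + m) i
rotate-rotate {r} m n i = toℕ-injective (begin
  toℕ (rotate m (rotate n i))     ≡⟨ toℕ-rotate m (rotate n i) ⟩
  (toℕ (rotate n i) + m) % r      ≡⟨ ≡.cong (λ x → (x + m) % r) (toℕ-rotate n i) ⟩
  ((toℕ i + n) % r + m) % r       ≡⟨ [m%n+k]%n≡[m+k]%n (toℕ i + n) m r ⟩
  (toℕ i + n + m) % r             ≡⟨ ≡.cong (_% r) (ℕ.+-assoc (toℕ i) n m) ⟩
  (toℕ i + (n + m)) % r           ≡⟨ toℕ-rotate (n + m) i ⟨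
  toℕ (rotate (n + m) i)          ∎)
  where open ≡-Reasoning

rotate≡id⇔∣ : ∀ {r} .{{_ : NonZero r}} n (i : Fin r) → rotate n i ≡ i ⇔ r ∣ n
rotate≡id⇔∣ {r} n i = mk⇔
  (λ e → Equivalence.to equiv (begin
    (toℕ i + n) % r     ≡⟨ toℕ-rotate n i ⟨
    toℕ (rotate n i)    ≡⟨ ≡.cong toℕ e ⟩
    toℕ i               ≡⟨ m<n⇒m%n≡m (toℕ<n i) ⟨
    toℕ i % r           ∎))
  (λ r∣n → toℕ-injective (begin
    toℕ (rotate n i)    ≡⟨ toℕ-rotate n i ⟩
    (toℕ i + n) % r     ≡⟨ Equivalence.from equiv r∣n ⟩
    toℕ i % r           ≡⟨ m<n⇒m%n≡m (toℕ<n i) ⟩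
    toℕ i               ∎))
  where
  open ≡-Reasoning
  equiv : (toℕ i + n) % r ≡ toℕ i % r ⇔ r ∣ n
  equiv = [m+n]%d≡m%d⇔d∣n (toℕ i) n r

-- `r ∸ toℕ i` stands for minus i modulo r, so the shift is j - i kept within the natural numbers.
rotate-onto : ∀ {r} .{{_ : NonZero r}} (i j : Fin r) → rotate (toℕ j + (r ∸ toℕ i)) i ≡ j
rotate-onto {r} i j = toℕ-injective (begin
  toℕ (rotate (toℕ j + (r ∸ toℕ i)) i)    ≡⟨ toℕ-rotate _ i ⟩
  (toℕ i + (toℕ j + (r ∸ toℕ i))) % r     ≡⟨ %-congˡ (x∙yz≈y∙xz (toℕ i) (toℕ j) _) ⟩
  (toℕ j + (toℕ i + (r ∸ toℕ i))) % r     ≡⟨ ≡.cong (λ n → (toℕ j + n) % r) (ℕ.m+[n∸m]≡n (ℕ.<⇒≤ (toℕ<n i))) ⟩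
  (toℕ j + r) % r                         ≡⟨ [m+n]%n≡m%n (toℕ j) r ⟩
  toℕ j % r                               ≡⟨ m<n⇒m%n≡m (toℕ<n j) ⟩
  toℕ j                                   ∎)
  where open ≡-Reasoning

rotate-zero : ∀ {r} .{{_ : NonZero r}} (i : Fin r) → rotate (toℕ i) (0 mod r) ≡ i
rotate-zero {r} i = toℕ-injective (begin
  toℕ (rotate (toℕ i) (0 mod r))    ≡⟨ toℕ-rotate (toℕ i) (0 mod r) ⟩
  (toℕ (0 mod r) + toℕ i) % r       ≡⟨ %-congˡ (≡.cong (_+ toℕ i) (toℕ-fromℕ< (m%n<n 0 r))) ⟩
  (0 % r + toℕ i) % r               ≡⟨ [m%n+k]%n≡[m+k]%n 0 (toℕ i) r ⟩
  toℕ i % r                         ≡⟨ m<n⇒m%n≡m (toℕ<n i) ⟩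
  toℕ i                             ∎)
  where open ≡-Reasoning

-- Iterates, periods and cycles

-- Stated for injections, so that it serves both the permutations induced by π and the first return
-- map on `Fin p`.
module Iteration {A : Setoid c ℓ} (f : Injection A A) where
  open Setoid A renaming (refl to ≈-refl)
  open Injection f using (to; cong; injective)

  iterate : ℕ → Carrier → Carrier
  iterate n x = fold x to n

  iterate-cong : ∀ n {x y} → x ≈ y → iterate n x ≈ iterate n y
  iterate-cong zero    e = e
  iterate-cong (suc n) e = cong (iterate-cong n e)

  iterate-injective : ∀ n {x y} → iterate n x ≈ iterate n y → x ≈ y
  iterate-injective zero    e = e
  iterate-injective (suc n) e = iterate-injective n (injective e)

  iterate-+ : ∀ m n x → iterate (m + n) x ≈ iterate m (iterate n x)
  iterate-+ m n x = reflexive (fold-+ x to m)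

  iterate-≡ : ∀ {m n} x → m ≡ n → iterate m x ≈ iterate n x
  iterate-≡ x e = reflexive (≡.cong (λ n → iterate n x) e)

  -- For positive r this says that r is the least positive return time of x. For r = 0 it says that
  -- x never returns, hence `NonZero r` is carried separately.
  Period : ℕ → Carrier → Set ℓ
  Period r x = ∀ n → iterate n x ≈ x ⇔ r ∣ n

  iterate-* : ∀ {r x} q → iterate r x ≈ x → iterate (q * r) x ≈ x
  iterate-*         zero    _ = ≈-refl
  iterate-* {r} {x} (suc q) e =
    trans (iterate-+ r (q * r) x) (trans (iterate-cong r (iterate-* q e)) e)

  iterate-% : ∀ {r x} .{{_ : NonZero r}} n → iterate r x ≈ x → iterate (n % r) x ≈ iterate n x
  iterate-% {r} {x} n e = sym (trans (iterate-≡ x (m≡m%n+[m/n]*n n r))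
    (trans (iterate-+ (n % r) (n / r * r) x) (iterate-cong (n % r) (iterate-* (n / r) e))))

  module _ {r x} (period : Period r x) where

    period⇒fixed : iterate r x ≈ x
    period⇒fixed = Equivalence.from (period r) ∣-refl

    -- By symmetry m ≤ n. Cancelling the injective m-fold iterate leaves x fixed by `n ∸ m` steps,
    -- so r divides the difference.
    iterate-injectiveˡ-% : .{{_ : NonZero r}} → ∀ m n → iterate m x ≈ iterate n x → m % r ≡ n % r
    iterate-injectiveˡ-% = wlog ℕ.≤-total (λ f e → ≡.sym (f (sym e))) λ m n m≤n e →
      let m+[n∸m]≡n = ℕ.m+[n∸m]≡n m≤n in
      ≡.trans
        (≡.sym (Equivalence.from ([m+n]%d≡m%d⇔d∣n m (n ∸ m) r)
          (Equivalence.to (period (n ∸ m)) (iterate-injective m (begin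
            iterate m (iterate (n ∸ m) x)    ≈⟨ iterate-+ m (n ∸ m) x ⟨
            iterate (m + (n ∸ m)) x          ≈⟨ iterate-≡ x m+[n∸m]≡n ⟩
            iterate n x                      ≈⟨ e ⟨
            iterate m x                      ∎)))))
        (≡.cong (_% r) m+[n∸m]≡n)
      where open SetoidReasoning A

    iterate-injectiveˡ : ∀ {i j : Fin r} → iterate (toℕ i) x ≈ iterate (toℕ j) x → i ≡ j
    iterate-injectiveˡ {i} {j} e = toℕ-injective (begin
      toℕ i        ≡⟨ m<n⇒m%n≡m (toℕ<n i) ⟨
      toℕ i % r    ≡⟨ iterate-injectiveˡ-% (toℕ i) (toℕ j) e ⟩
      toℕ j % r    ≡⟨ m<n⇒m%n≡m (toℕ<n j) ⟩
      toℕ j        ∎)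
      where
      open ≡-Reasoning
      instance
        _ = nonZeroIndex i

    iterate-mod : .{{_ : NonZero r}} → ∀ n → iterate (toℕ (n mod r)) x ≈ iterate n x
    iterate-mod n =
      trans (iterate-≡ x (toℕ-fromℕ< (m%n<n n r))) (iterate-% n period⇒fixed)

  Reaches : Carrier → Carrier → Set ℓ
  Reaches x y = ∃ λ n → iterate n x ≈ y

  -- `n * r` steps are n full periods, so the steps that remain after the first n lead back to x.
  reaches-sym : ∀ {r x y} .{{_ : NonZero r}} → Period r x → Reaches x y → Reaches y x
  reaches-sym {r} {x} {y} period (n , e) = n * r ∸ n , (begin
    iterate (n * r ∸ n) y                ≈⟨ iterate-cong (n * r ∸ n) e ⟨
    iterate (n * r ∸ n) (iterate n x)    ≈⟨ iterate-+ (n * r ∸ n) n x ⟨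
    iterate (n * r ∸ n + n) x            ≈⟨ iterate-≡ x (ℕ.m∸n+n≡m (ℕ.m≤m*n n r)) ⟩
    iterate (n * r) x                    ≈⟨ iterate-* n (period⇒fixed period) ⟩
    x                                    ∎)
    where open SetoidReasoning A

  reaches-trans : ∀ {x y z} → Reaches x y → Reaches y z → Reaches x z
  reaches-trans {x} (m , e) (n , e′) =
    n + m , trans (iterate-+ n m x) (trans (iterate-cong n e) e′)

  period-cong : ∀ {r x y} → x ≈ y → Period r x → Period r y
  period-cong e period n = mk⇔
    (λ y-fixed → Equivalence.to (period n) (trans (iterate-cong n e) (trans y-fixed (sym e))))
    (λ r∣n → trans (iterate-cong n (sym e)) (trans (Equivalence.from (period n) r∣n) e))

  period-unique : ∀ {r s x} → Period r x → Period s x → r ≡ s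
  period-unique {r} {s} r-period s-period = ∣-antisym
    (Equivalence.to (r-period s) (period⇒fixed s-period))
    (Equivalence.to (s-period r) (period⇒fixed r-period))

  module _ (_≈?_ : Decidable _≈_) where

    -- Iterates repeat modulo r, so testing the exponents below r suffices.
    reaches? : ∀ {r x} .{{_ : NonZero r}} → Period r x → ∀ y → Dec (Reaches x y)
    reaches? {r} {x} period y = map′
      (λ (i , e) → toℕ i , e)
      (λ (n , e) → n mod r , trans (iterate-mod period n) e)
      (any? {n = r} (λ i → iterate (toℕ i) x ≈? y))

    abstract
      -- Descent on return times: a smaller positive one replaces n. Once there is none, n is the
      -- period, because the remainder `m % n` of any return time m is again a return time and must
      -- be 0.
      findPeriod : ∀ n .{{_ : NonZero n}} x → iterate n x ≈ x → ∃ λ r → NonZero r × Period r x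
      findPeriod n x = search n (<-wellFounded n)
        where
        search : ∀ n .{{_ : NonZero n}} → Acc _<_ n → iterate n x ≈ x → ∃ λ r → NonZero r × Period r x
        search n (acc rec) e
          with any? {n = n} (λ i → ¬? (toℕ i ℕ.≟ 0) ×-dec (iterate (toℕ i) x ≈? x))
        ... | yes (i , i≢0 , e′) = search (toℕ i) {{≢-nonZero i≢0}} (rec (toℕ<n i)) e′
        ... | no minimal = n , ≢-nonZero (≢-nonZero⁻¹ n) , λ m → mk⇔
          (λ e′ → m%n≡0⇒n∣m m n (decidable-stable (m % n ℕ.≟ 0) λ m%n≢0 →
            minimal (m mod n
              , (λ z → m%n≢0 (≡.trans (≡.sym (toℕ-fromℕ< (m%n<n m n))) z))
              , trans (iterate-≡ x (toℕ-fromℕ< (m%n<n m n))) (trans (iterate-% m e) e′))))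
          (λ { (divides-refl q) → iterate-* q e })

-- Cycles as orbits

module _ {A : Setoid c ℓ} {f : Bijection A A} where
  open Setoid A renaming (refl to ≈-refl)
  open Iteration (Bijection.injection f)
  open Cycle

  -- `0 mod length C` is the index zero, written this way since the length is nonzero without being
  -- syntactically a successor.
  base : Cycle f → Carrier
  base C = entry C (0 mod length C)

  iterate-entry : ∀ (C : Cycle f) n i → iterate n (entry C i) ≈ entry C (rotate n i)
  iterate-entry C zero i =
    reflexive (≡.cong (entry C) (≡.sym (Equivalence.from (rotate≡id⇔∣ 0 i) (length C ∣0))))
  iterate-entry C (suc n) i = begin
    Bijection.to f (iterate n (entry C i))    ≈⟨ Bijection.cong f (iterate-entry C n i) ⟩
    Bijection.to f (entry C (rotate n i))     ≈⟨ entry-step C (rotate n i) ⟩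
    entry C (rotate 1 (rotate n i))           ≡⟨ ≡.cong (entry C) (rotate-rotate 1 n i) ⟩
    entry C (rotate (n + 1) i)                ≡⟨ ≡.cong (λ m → entry C (rotate m i)) (ℕ.+-comm n 1) ⟩
    entry C (rotate (suc n) i)                ∎
    where open SetoidReasoning A

  -- n steps rotate the index by n. As the entries are distinct, an entry recurs exactly when the
  -- rotation fixes its index.
  entry-period : ∀ (C : Cycle f) i → Period (length C) (entry C i)
  entry-period C i n = mk⇔
    (λ e → Equivalence.to (rotate≡id⇔∣ n i)
      (entry-distinct C (trans (sym (iterate-entry C n i)) e)))
    (λ r∣n → trans (iterate-entry C n i)
      (reflexive (≡.cong (entry C) (Equivalence.from (rotate≡id⇔∣ n i) r∣n))))

  iterate-base : ∀ (C : Cycle f) i → iterate (toℕ i) (base C) ≈ entry C i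
  iterate-base C i = trans (iterate-entry C (toℕ i) (0 mod length C))
    (reflexive (≡.cong (entry C) (rotate-zero i)))

  iterate-onto : ∀ (C : Cycle f) i j →
                 iterate (toℕ j + (length C ∸ toℕ i)) (entry C i) ≈ entry C j
  iterate-onto C i j = trans (iterate-entry C _ i)
    (reflexive (≡.cong (entry C) (rotate-onto i j)))

  orbit : ∀ r .{{_ : NonZero r}} x → Period r x → Cycle f
  orbit r x period = record
    { length         = r
    ; entry          = λ i → iterate (toℕ i) x
    ; entry-distinct = iterate-injectiveˡ period
    -- The successor of the last index wraps round to zero; `iterate-mod` absorbs this because r
    -- steps fix x.
    ; entry-step     = λ i → trans (iterate-≡ x (≡.sym (ℕ.+-comm (toℕ i) 1)))
                                   (sym (iterate-mod period (toℕ i + 1)))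
    }

  abstract
    cycleThrough : Decidable _≈_ → ∀ n .{{_ : NonZero n}} x → iterate n x ≈ x →
                   Σ[ C ∈ Cycle f ] ∃ λ i → entry C i ≈ x
    cycleThrough _≈?_ n x e with r , r≢0 , period ← findPeriod _≈?_ n x e =
      let instance _ = r≢0
      in  orbit r x period , 0 mod r , iterate-mod period 0

  -- Both lengths are the period of the shared point. From it, `C` arrives at entry l after
  -- `toℕ l + (length C ∸ toℕ i)` steps; the same steps in `D` from index j show that the shift is j
  -- - i.
  common-entry⇒∼ : ∀ (C D : Cycle f) {i j} → entry C i ≈ entry D j → C ∼ D
  common-entry⇒∼ C D {i} {j} e = eq , toℕ j + (length C ∸ toℕ i) , λ l → begin
    entry C l                                                     ≈⟨ iterate-onto C i l ⟨
    iterate (toℕ l + (length C ∸ toℕ i)) (entry C i)              ≈⟨ iterate-cong (toℕ l + (length C ∸ toℕ i)) e ⟩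
    iterate (toℕ l + (length C ∸ toℕ i)) (entry D j)              ≈⟨ iterate-entry D _ j ⟩
    entry D (rotate (toℕ l + (length C ∸ toℕ i)) j)               ≡⟨ ≡.cong (entry D) (shift l) ⟩
    entry D (rotate (toℕ j + (length C ∸ toℕ i)) (cast eq l))     ∎
    where
    open SetoidReasoning A
    eq : length C ≡ length D
    eq = period-unique (period-cong e (entry-period C i)) (entry-period D j)

    shift : ∀ l → rotate (toℕ l + (length C ∸ toℕ i)) j
                ≡ rotate (toℕ j + (length C ∸ toℕ i)) (cast eq l)
    shift l = toℕ-injective (≡.trans (toℕ-rotate _ j) (≡.trans
      (%-congˡ (≡.trans (x∙yz≈y∙xz (toℕ j) (toℕ l) _)
        (≡.cong (_+ (toℕ j + (length C ∸ toℕ i))) (≡.sym (toℕ-cast eq l)))))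
      (≡.sym (toℕ-rotate _ (cast eq l)))))

  reaches⇒∼ : ∀ (C D : Cycle f) {i j} → Reaches (entry C i) (entry D j) → C ∼ D
  reaches⇒∼ C D (n , e) = common-entry⇒∼ C D (trans (sym (iterate-entry C n _)) e)

  ∼⇒reaches : ∀ (C D : Cycle f) → C ∼ D → ∀ i j → Reaches (entry C i) (entry D j)
  ∼⇒reaches C D (eq , t , e) i j =
    reaches-trans (0 , e i) (toℕ j + (length D ∸ toℕ i′) , iterate-onto D i′ j)
    where
    i′ : Fin (length D)
    i′ = rotate t (cast eq i)

-- Orbits on a finite set

module _ {n : ℕ} (σ : Injection (setoid (Fin n)) (setoid (Fin n))) where
  open Iteration σ

  -- Since distinct representatives have disjoint orbits, `sum≡n` expresses that the orbits fill
  -- `Fin n`.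
  record OrbitDecomposition : Set where
    field
      {size}         : ℕ
      representative : Fin size → Fin n
      period         : Fin size → ℕ
      period≢0       : ∀ i → NonZero (period i)
      isPeriod       : ∀ i → Period (period i) (representative i)
      disjoint       : Injective _≡_ Reaches representative
      sum≡n          : sum period ≡ n

  private
    abstract
      -- Among the iterates with exponents 0 to n two agree, and cancelling the smaller exponent by
      -- injectivity gives a positive return time.
      finite-period : ∀ i → ∃ λ r → NonZero r × Period r i
      finite-period i with pigeonhole (ℕ.n<1+n n) (λ k → iterate (toℕ k) i)
      ... | k , l , k<l , e = findPeriod Fin._≟_ (toℕ l ∸ toℕ k) {{>-nonZero (ℕ.m<n⇒0<n∸m k<l)}} i
        (iterate-injective (toℕ k) (≡.trans (≡.sym (iterate-+ (toℕ k) (toℕ l ∸ toℕ k) i))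
          (≡.trans (iterate-≡ i (ℕ.m+[n∸m]≡n (ℕ.<⇒≤ k<l))) (≡.sym e))))

    period-of : Fin n → ℕ
    period-of i = proj₁ (finite-period i)

    instance
      period-of≢0 : ∀ {i} → NonZero (period-of i)
      period-of≢0 {i} = proj₁ (proj₂ (finite-period i))

    period-of-isPeriod : ∀ i → Period (period-of i) i
    period-of-isPeriod i = proj₂ (proj₂ (finite-period i))

  abstract
    -- A transversal of `Reaches` picks one point in each orbit. The map `point`, defined on pairs
    -- of an orbit and a position below its period, is a bijection onto `Fin n`; counting gives the
    -- sum of the periods.
    orbitDecomposition : OrbitDecomposition
    orbitDecomposition
      with transversal {_~_ = Reaches} (0 , refl)
             (λ {i} → reaches-sym (period-of-isPeriod i))
             (λ i → reaches? Fin._≟_ (period-of-isPeriod i))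
    ... | m , t , t-injective , t-covers = record
      { representative = t
      ; period         = period-of ∘ t
      ; period≢0       = λ i → period-of≢0
      ; isPeriod       = period-of-isPeriod ∘ t
      ; disjoint       = t-injective
      ; sum≡n          = ↔⇒≡ (↔-trans (Fin-sum↔Σ (period-of ∘ t))
                                (⤖⇒↔ (mk⤖ (point-injective , point-surjective))))
      }
      where
      point : Σ[ i ∈ Fin m ] Fin (period-of (t i)) → Fin n
      point (i , j) = iterate (toℕ j) (t i)

      point-injective : Injective _≡_ _≡_ point
      point-injective {i , j} {i′ , j′} e = same-orbit (t-injective (reaches-trans (toℕ j , e)
        (reaches-sym (period-of-isPeriod (t i′)) (toℕ j′ , refl)))) e
        where
        -- Variable indices allow the equality of orbits to be matched with `refl`.
        same-orbit : ∀ {i i′ j j′} → i ≡ i′ → point (i , j) ≡ point (i′ , j′) →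
                     _≡_ {A = Σ[ i ∈ Fin m ] Fin (period-of (t i))} (i , j) (i′ , j′)
        same-orbit {i} refl e = ≡.cong (i ,_) (iterate-injectiveˡ (period-of-isPeriod (t i)) e)

      point-surjective : ∀ u → ∃ λ x → ∀ {y} → y ≡ x → point y ≡ u
      point-surjective u with t-covers u
      ... | i , k , e = (i , k mod period-of (t i)) ,
        λ { refl → ≡.trans (iterate-mod (period-of-isPeriod (t i)) k) e }

-- Congruences in ℤ and ℤₚ

infix 4 _≋_[_]
_≋_[_] : ℤ → ℤ → ℕ → Set
a ≋ b [ n ] = CommutativeRing._≈_ (ℤ/ n) a b

module _ {n : ℕ} where
  open CommutativeRing (ℤ/ n) public using () renaming
    ( refl to ≋-refl ; sym to ≋-sym ; trans to ≋-trans ; reflexive to ≋-reflexive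
    ; +-cong to +-cong-≋ ; -‿cong to neg-cong-≋ )

_≋?_[_] : ∀ a b n → Dec (a ≋ b [ n ])
a ≋? b [ n ] = map′
  (λ (ℤ∣.divides q e) → congruent (q , ≡.sym e))
  (λ { (congruent (q , e)) → ℤ∣.divides q (≡.sym e) })
  (+ n ℤ∣.∣? (a ℤ.- b))

multiple⇒≋ : ∀ {n a b} q → a ≡ b ℤ.+ q ℤ.* + n → a ≋ b [ n ]
multiple⇒≋ {n} {b = b} q refl = congruent (q , identity b q (+ n))
  where
  identity : ∀ b q n → q ℤ.* n ≡ b ℤ.+ q ℤ.* n ℤ.- b
  identity = solve-∀

≋⇒∣- : ∀ {n a b} → a ≋ b [ n ] → ∃ λ q → q ℤ.* + n ≡ a ℤ.- b
≋⇒∣- (congruent (q , e)) = q , e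

≋⇒multiple : ∀ {n a b} → a ≋ b [ n ] → ∃ λ q → a ≡ b ℤ.+ q ℤ.* + n
≋⇒multiple {n} {a} {b} e with ≋⇒∣- e
... | q , qn≡ = q , ≡.trans (identity a b) (≡.cong (λ z → b ℤ.+ z) (≡.sym qn≡))
  where
  identity : ∀ a b → a ≡ b ℤ.+ (a ℤ.- b)
  identity = solve-∀

≋-weaken : ∀ {m n a b} → m ∣ n → a ≋ b [ n ] → a ≋ b [ m ]
≋-weaken {m} {b = b} (divides-refl d) e with ≋⇒multiple e
... | q , a≡ = multiple⇒≋ (q ℤ.* + d) (≡.trans a≡ (≡.cong (λ z → b ℤ.+ z)
  (≡.trans (≡.cong (q ℤ.*_) (ℤ.pos-* d m)) (≡.sym (ℤ.*-assoc q (+ d) (+ m))))))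

*-cancelʳ-≋ : ∀ {n a b} m .{{_ : NonZero m}} → a ℤ.* + m ≋ b ℤ.* + m [ n * m ] → a ≋ b [ n ]
*-cancelʳ-≋ {n} {a} {b} m e with ≋⇒multiple e
... | q , am≡ = multiple⇒≋ q (ℤ.*-cancelʳ-≡ a _ (+ m) (begin
  a ℤ.* + m                                ≡⟨ am≡ ⟩
  b ℤ.* + m ℤ.+ q ℤ.* + (n * m)            ≡⟨ ≡.cong (λ z → b ℤ.* + m ℤ.+ q ℤ.* z) (ℤ.pos-* n m) ⟩
  b ℤ.* + m ℤ.+ q ℤ.* (+ n ℤ.* + m)        ≡⟨ identity b q (+ n) (+ m) ⟩
  (b ℤ.+ q ℤ.* + n) ℤ.* + m                ∎))
  where
  open ≡-Reasoning
  identity : ∀ b q n m → b ℤ.* m ℤ.+ q ℤ.* (n ℤ.* m) ≡ (b ℤ.+ q ℤ.* n) ℤ.* m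
  identity = solve-∀

multiple≋0 : ∀ q n → q ℤ.* + n ≋ ℤ.0ℤ [ n ]
multiple≋0 q n = multiple⇒≋ q (≡.sym (ℤ.+-identityˡ _))

-≋0⇒≋ : ∀ {n a b} → a ℤ.- b ≋ ℤ.0ℤ [ n ] → a ≋ b [ n ]
-≋0⇒≋ {n} = RingProperties.x∙y⁻¹≈ε⇒x≈y (CommutativeRing.ring (ℤ/ n)) _ _

+-cancelˡ-≋ : ∀ {n} c {a b} → c ℤ.+ a ≋ c ℤ.+ b [ n ] → a ≋ b [ n ]
+-cancelˡ-≋ {n} c = RingProperties.+-cancelˡ (CommutativeRing.ring (ℤ/ n)) c _ _

n∣m<n⇒m≡0 : ∀ {m n} → n ∣ m → m < n → m ≡ 0
n∣m<n⇒m≡0 {zero}  _   _   = refl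
n∣m<n⇒m≡0 {suc m} n∣m m<n = contradiction n∣m (>⇒∤ m<n)

-- Two numbers below n have a difference below n, which is 0 if n divides it.
toℕ-injective-≋ : ∀ {n} {i j : Fin n} → + toℕ i ≋ + toℕ j [ n ] → i ≡ j
toℕ-injective-≋ {n} {i} {j} =
  wlog {Q = λ i j → + toℕ i ≋ + toℕ j [ n ] → i ≡ j}
    (λ i j → ℕ.≤-total (toℕ j) (toℕ i)) (λ f e → ≡.sym (f (≋-sym e)))
    difference i j
  where
  difference : ∀ i j → toℕ j ≤ toℕ i → + toℕ i ≋ + toℕ j [ n ] → i ≡ j
  difference i j j≤i e with ≋⇒∣- e
  ... | q , qn≡ = toℕ-injective (ℕ.≤-antisym
    (ℕ.m∸n≡0⇒m≤n (n∣m<n⇒m≡0 n∣i∸j (ℕ.≤-<-trans (ℕ.m∸n≤m (toℕ i) (toℕ j)) (toℕ<n i)))) j≤i)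
    where
    n∣i∸j : n ∣ toℕ i ∸ toℕ j
    n∣i∸j = ℤ∣.∣⇒∣ᵤ (ℤ∣.divides q (begin
      + (toℕ i ∸ toℕ j)         ≡⟨ ℤ.⊖-≥ j≤i ⟨
      toℕ i ℤ.⊖ toℕ j           ≡⟨ ℤ.m-n≡m⊖n (toℕ i) (toℕ j) ⟨
      + toℕ i ℤ.- + toℕ j       ≡⟨ qn≡ ⟨
      q ℤ.* + n                 ∎))
      where open ≡-Reasoning

module _ {p : ℕ} where
  open PAdic

  component-≋-+ : ∀ (x : PAdic p) d k → component x (d + k) ≋ component x k [ p ^ k ]
  component-≋-+ x zero    k = ≋-refl
  component-≋-+ x (suc d) k = ≋-trans
    (≋-weaken (divides (p ^ d) (ℕ.^-distribˡ-+-* p d k)) (coherent x (d + k)))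
    (component-≋-+ x d k)

  component-≋-≤ : ∀ (x : PAdic p) {k l} → k ≤ l → component x l ≋ component x k [ p ^ k ]
  component-≋-≤ x {k} {l} k≤l = ≡.subst (λ l → component x l ≋ component x k [ p ^ k ])
    (ℕ.m∸n+n≡m k≤l) (component-≋-+ x (l ∸ k) k)

  ≡mod⇒component : ∀ k {x y : PAdic p} → x ≡ y [mod p ^ k ] →
                   component x k ≋ component y k [ p ^ k ]
  ≡mod⇒component k {x} {y} (congruent (q , e)) = -≋0⇒≋
    (≋-trans (≋-sym (_≈ₚ_.at e k)) (multiple≋0 (component q k) (p ^ k)))

  module _ .{{_ : NonZero p}} where

    abstract
      -- With `≡mod⇒component` this reduces congruence of p-adic integers to congruence of integers,
      -- which is decidable. The quotient of x - y by p^k is built componentwise: its j-th component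
      -- is the difference of the components of x and y at level j + k, divided by p^k.
      component⇒≡mod : ∀ k {x y : PAdic p} → component x k ≋ component y k [ p ^ k ] →
                       x ≡ y [mod p ^ k ]
      component⇒≡mod k {x} {y} e = congruent (q , componentwise quotient-eq)
        where
        deep : ∀ j → component x (j + k) ≋ component y (j + k) [ p ^ k ]
        deep j = ≋-trans (component-≋-+ x j k)
          (≋-trans e (≋-sym (component-≋-+ y j k)))

        -- Dividing by p^k loses k digits of precision, hence the shift of the index.
        qⱼ : ℕ → ℤ
        qⱼ j = proj₁ (≋⇒∣- (deep j))

        qⱼ-eq : ∀ j → qⱼ j ℤ.* + (p ^ k) ≡ component x (j + k) ℤ.- component y (j + k)
        qⱼ-eq j = proj₂ (≋⇒∣- (deep j))

        qⱼ-coherent : ∀ j → qⱼ (suc j) ≋ qⱼ j [ p ^ j ]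
        -- Consecutive numerators agree modulo p^(j+k); cancelling p^k leaves agreement modulo p^j.
        qⱼ-coherent j = *-cancelʳ-≋ (p ^ k) {{ℕ.m^n≢0 p k}} (≡.subst
          (λ n → qⱼ (suc j) ℤ.* + (p ^ k) ≋ qⱼ j ℤ.* + (p ^ k) [ n ])
          (ℕ.^-distribˡ-+-* p j k)
          (≋-trans (≋-reflexive (qⱼ-eq (suc j)))
            (≋-trans (+-cong-≋ (coherent x (j + k)) (neg-cong-≋ (coherent y (j + k))))
              (≋-reflexive (≡.sym (qⱼ-eq j))))))

        q : PAdic p
        q = record { component = qⱼ ; coherent = qⱼ-coherent }

        quotient-eq : ∀ j → qⱼ j ℤ.* + (p ^ k) ≋ component x j ℤ.- component y j [ p ^ j ]
        quotient-eq j = ≋-trans (≋-reflexive (qⱼ-eq j))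
          (+-cong-≋ (component-≋-≤ x (ℕ.m≤m+n j k))
                    (neg-cong-≋ (component-≋-≤ y (ℕ.m≤m+n j k))))

    ≡mod? : ∀ k (x y : PAdic p) → Dec (x ≡ y [mod p ^ k ])
    ≡mod? k x y = map′ (component⇒≡mod k) (≡mod⇒component k)
      (component x k ≋? component y k [ p ^ k ])

    -- The p classes modulo p^(k+1) above the class of a modulo p^k are represented by a + t p^k,
    -- with t as the new digit.
    module Lifts (k : ℕ) (a : PAdic p) where

      abstract
        lift : Fin p → PAdic p
        lift t = CommutativeRing._+_ (ℤₚ p) a (fromℤ p (+ toℕ t ℤ.* + (p ^ k)))

        lift-≡ : ∀ t → lift t ≡ a [mod p ^ k ]
        lift-≡ t = component⇒≡mod k (multiple⇒≋ (+ toℕ t) refl)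

        lift-injective : ∀ {t u} → lift t ≡ lift u [mod p ^ suc k ] → t ≡ u
        lift-injective {t} {u} e = toℕ-injective-≋
          (*-cancelʳ-≋ (p ^ k) {{ℕ.m^n≢0 p k}} (+-cancelˡ-≋ (component a (suc k)) (≡mod⇒component (suc k) e)))

        -- At level k + 1, x and a differ by some q p^k. The digit t is q mod p, and the rest of q
        -- contributes a multiple of p^(k+1).
        lift-covers : ∀ x → x ≡ a [mod p ^ k ] → ∃ λ t → lift t ≡ x [mod p ^ suc k ]
        lift-covers x x≡a = t , component⇒≡mod (suc k) (≋-sym (multiple⇒≋ q/p (begin
          component x (suc k)
            ≡⟨ proj₂ multiple ⟩
          a₊ ℤ.+ q ℤ.* P
            ≡⟨ ≡.cong (λ z → a₊ ℤ.+ z ℤ.* P) (ℤ.a≡a%ℕn+[a/ℕn]*n q p) ⟩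
          a₊ ℤ.+ (+ (q ℤ.%ℕ p) ℤ.+ q/p ℤ.* + p) ℤ.* P
            ≡⟨ identity a₊ (+ (q ℤ.%ℕ p)) q/p (+ p) P ⟩
          a₊ ℤ.+ + (q ℤ.%ℕ p) ℤ.* P ℤ.+ q/p ℤ.* (+ p ℤ.* P)
            ≡⟨ ≡.cong₂ (λ d z → a₊ ℤ.+ + d ℤ.* P ℤ.+ q/p ℤ.* z)
                 (≡.sym (toℕ-fromℕ< (ℤ.n%ℕd<d q p))) (≡.sym (ℤ.pos-* p (p ^ k))) ⟩
          a₊ ℤ.+ + toℕ t ℤ.* P ℤ.+ q/p ℤ.* + (p ^ suc k) ∎)))
          where
          open ≡-Reasoning
          a₊ P q q/p : ℤ
          a₊ = component a (suc k)
          P = + (p ^ k)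

          multiple : ∃ λ q → component x (suc k) ≡ a₊ ℤ.+ q ℤ.* P
          multiple = ≋⇒multiple (≋-trans (coherent x k)
            (≋-trans (≡mod⇒component k x≡a) (≋-sym (coherent a k))))

          q = proj₁ multiple
          q/p = q ℤ./ℕ p

          t : Fin p
          t = fromℕ< (ℤ.n%ℕd<d q p)

          identity : ∀ a t d p r → a ℤ.+ (t ℤ.+ d ℤ.* p) ℤ.* r ≡ a ℤ.+ t ℤ.* r ℤ.+ d ℤ.* (p ℤ.* r)
          identity = solve-∀

-- Children

module _ {p : ℕ} .{{_ : NonZero p}} (π : PAdicPermutation p) (k : ℕ) where
  open Cycle

  private
    module Coarse = Setoid (ℤₚ/ p (p ^ k))
    module Fine = Setoid (ℤₚ/ p (p ^ suc k))
    module Coarseⁱ = Iteration (Bijection.injection (induced π k))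
    module Fineⁱ = Iteration (Bijection.injection (induced π (suc k)))

  coarsen : ∀ {x y : PAdic p} → x ≡ y [mod p ^ suc k ] → x ≡ y [mod p ^ k ]
  coarsen {x} {y} e = component⇒≡mod k
    (≋-trans (≋-sym (PAdic.coherent x k))
      (≋-trans (≋-weaken (n∣m*n p) (≡mod⇒component (suc k) e)) (PAdic.coherent y k)))

  coarsen-reaches : ∀ {x y} → Fineⁱ.Reaches x y → Coarseⁱ.Reaches x y
  coarsen-reaches (n , e) = n , coarsen e

  module Children (S : Cycle (induced π k)) where

    open Lifts k (base S)

    private
      r : ℕ
      r = length S

    iterate-lift-≡ : ∀ n t → Coarseⁱ.iterate n (lift t) ≡ Coarseⁱ.iterate n (base S) [mod p ^ k ]
    iterate-lift-≡ n t = Coarseⁱ.iterate-cong n (lift-≡ t)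

    base-period : Coarseⁱ.Period r (base S)
    base-period = entry-period S (0 mod r)

    private
      returns : ∀ t → ∃ λ u → lift u ≡ Fineⁱ.iterate r (lift t) [mod p ^ suc k ]
      returns t = lift-covers (Fineⁱ.iterate r (lift t))
        (Coarse.trans (iterate-lift-≡ r t) (Coarseⁱ.period⇒fixed base-period))

    abstract
      -- `S` closes up after r steps, so a lift of its base then arrives at a lift of the base again
      -- (`returns`). Injectivity comes from that of the r-th iterate of π_(k+1). Outside the
      -- `abstract` block the values of the map are known only through `lift-firstReturn`.
      firstReturn : Injection (setoid (Fin p)) (setoid (Fin p))

      lift-firstReturn : ∀ t → lift (Injection.to firstReturn t) ≡ Fineⁱ.iterate r (lift t)
                                 [mod p ^ suc k ]

      firstReturn = record
        { to        = λ t → proj₁ (returns t)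
        ; cong      = ≡.cong _
        ; injective = λ {t} {u} e → lift-injective (Fineⁱ.iterate-injective r (Fine.trans
            (Fine.sym (proj₂ (returns t)))
            (Fine.trans (Fine.reflexive (≡.cong lift e)) (proj₂ (returns u)))))
        }

      lift-firstReturn t = proj₂ (returns t)

    module Returnⁱ = Iteration firstReturn

    lift-return : ∀ q t →
                  lift (Returnⁱ.iterate q t) ≡ Fineⁱ.iterate (q * r) (lift t) [mod p ^ suc k ]
    lift-return zero    t = Fine.refl
    lift-return (suc q) t = begin
      lift (Returnⁱ.iterate (suc q) t)                  ≈⟨ lift-firstReturn (Returnⁱ.iterate q t) ⟩
      Fineⁱ.iterate r (lift (Returnⁱ.iterate q t))      ≈⟨ Fineⁱ.iterate-cong r (lift-return q t) ⟩
      Fineⁱ.iterate r (Fineⁱ.iterate (q * r) (lift t))  ≈⟨ Fineⁱ.iterate-+ r (q * r) (lift t) ⟨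
      Fineⁱ.iterate (suc q * r) (lift t)                ∎
      where open SetoidReasoning (ℤₚ/ p (p ^ suc k))

    -- Modulo p^k all lifts coincide with the base of `S`, so a path between two lifts has length a
    -- multiple of r and decomposes into first returns.
    reaches-lift : ∀ n t u → Fineⁱ.iterate n (lift t) ≡ lift u [mod p ^ suc k ] →
                   ∃ λ q → n ≡ q * r × Returnⁱ.iterate q t ≡ u
    reaches-lift n t u e = _∣_.quotient r∣n , _∣_.equality r∣n , lift-injective (Fine.trans
      (lift-return (_∣_.quotient r∣n) t)
      (Fine.trans (Fineⁱ.iterate-≡ (lift t) (≡.sym (_∣_.equality r∣n))) e))
      where
      r∣n : r ∣ n
      r∣n = Equivalence.to (base-period n)
        (Coarse.trans (Coarse.sym (iterate-lift-≡ n t)) (Coarse.trans (coarsen e) (lift-≡ u)))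

    -- By `reaches-lift`, a return time of `lift t` has the form `q * r` with q a return time of t.
    lift-period : ∀ {s t} → Returnⁱ.Period s t → Fineⁱ.Period (s * r) (lift t)
    lift-period {s} {t} period n = mk⇔
      (λ e → let (q , n≡qr , fixed) = reaches-lift n t t e in
        ≡.subst (s * r ∣_) (≡.sym n≡qr) (*-monoˡ-∣ r (Equivalence.to (period q) fixed)))
      (λ { (divides-refl q) → Fineⁱ.iterate-* q
        (Fine.trans (Fine.sym (lift-return s t))
          (Fine.reflexive (≡.cong lift (Returnⁱ.period⇒fixed period)))) })

    open OrbitDecomposition (orbitDecomposition firstReturn)

    private
      instance
        period*r≢0 : ∀ {n} → NonZero (period n * r)
        period*r≢0 {n} = ℕ.m*n≢0 (period n) r {{period≢0 n}}

    children : Fin size → Cycle (induced π (suc k))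
    children n = orbit (period n * r) (lift (representative n)) (lift-period (isPeriod n))

    areChildren : AreChildren π k S children
    areChildren = record
      { 1≤m      = 0<sum⇒0<m period (≡.subst (0 <_) (≡.sym sum≡n) (>-nonZero⁻¹ p))
      -- Equal representatives reach one another in 0 steps, so by `disjoint` the representatives
      -- are injected into `Fin p`.
      ; m≤p      = injective⇒≤ (λ {i} {j} e → disjoint (0 , e))
      ; length∣  = λ n → divides (period n) refl
      ; 1≤ratio  = λ n → >-nonZero⁻¹ (period n) {{period≢0 n}}
      ; ratio≤p  = λ n → ≡.subst (period n ≤_) sum≡n (f≤sum period n)
      ; sum≡p    = sum≡n
      ; distinct = distinct
      ; lifts    = lifts
      }
      where
      -- The index `combine j i` is `r * toℕ j + toℕ i`, and j full turns of `S` fix its base modulo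
      -- p^k.
      lifts : ∀ n (i : Fin r) (j : Fin (period n)) →
              entry S i ≡ Fineⁱ.iterate (toℕ (cast refl (combine j i))) (lift (representative n))
                [mod p ^ k ]
      lifts n i j = begin
        entry S i                                     ≈⟨ iterate-base S i ⟨
        iterate (toℕ i) (base S)                      ≈⟨ iterate-cong (toℕ i) rj-fixed ⟨
        iterate (toℕ i) (iterate rj (base S))         ≈⟨ iterate-+ (toℕ i) rj (base S) ⟨
        iterate (toℕ i + rj) (base S)                 ≈⟨ iterate-lift-≡ (toℕ i + rj) (representative n) ⟨
        iterate (toℕ i + rj) (lift (representative n)) ≈⟨ iterate-≡ (lift (representative n)) i+rj≡index ⟩
        iterate (toℕ (cast refl (combine j i))) (lift (representative n)) ∎
        where
        open Coarseⁱ
        open SetoidReasoning (ℤₚ/ p (p ^ k))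

        rj : ℕ
        rj = r * toℕ j

        rj-fixed : iterate rj (base S) ≡ base S [mod p ^ k ]
        rj-fixed = Equivalence.from (base-period rj) (m∣m*n (toℕ j))

        i+rj≡index : toℕ i + rj ≡ toℕ (cast refl (combine j i))
        i+rj≡index = ≡.trans (ℕ.+-comm (toℕ i) rj)
          (≡.trans (≡.sym (toℕ-combine j i)) (≡.sym (toℕ-cast refl (combine j i))))

      -- Equivalent children give a path between two lifted representatives; `reaches-lift` turns it
      -- into a path of the first return map, so both representatives lie in one orbit.
      distinct : Injective _≡_ _∼_ children
      distinct {m} {n} e =
        let b₁ = 0 mod (period m * r)
            b₂ = 0 mod (period n * r)
            (d , reach) = Fineⁱ.reaches-trans (toℕ b₁ , Fine.refl)
              (Fineⁱ.reaches-trans (∼⇒reaches (children m) (children n) e b₁ b₂)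
                (Fineⁱ.reaches-sym (lift-period (isPeriod n)) (toℕ b₂ , Fine.refl)))
            (q , _ , return) = reaches-lift d (representative m) (representative n) reach
        in disjoint (q , return)

  -- The parent of a cycle

  module _ (U : Cycle (induced π (suc k))) where

    private
      x : PAdic p
      x = base U

      -- `length U` steps fix x modulo p^(k+1), hence modulo p^k, so the class of x lies on a cycle
      -- of π_k.
      through-x : Σ[ C ∈ Cycle (induced π k) ] ∃ λ i → entry C i ≡ x [mod p ^ k ]
      through-x = cycleThrough (≡mod? k) (length U) x
        (coarsen (Fineⁱ.period⇒fixed (entry-period U (0 mod length U))))

    parent : Cycle (induced π k)
    parent = proj₁ through-x

    private
      iₓ : Fin (length parent)
      iₓ = proj₁ (proj₂ through-x)

      entry-parent≡x : entry parent iₓ ≡ x [mod p ^ k ]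
      entry-parent≡x = proj₂ (proj₂ through-x)

    module _ (S : Cycle (induced π k)) {m : ℕ} (T : Fin m → Cycle (induced π (suc k)))
             (T-children : AreChildren π k S T) where
      open AreChildren T-children

      index : ∀ n → Fin (length S) → Fin (ratio n) → Fin (length (T n))
      index n i j = cast (≡.sym (_∣_.equality (length∣ n))) (combine j i)

      index-injective : ∀ n i {j j′} → index n i j ≡ index n i j′ → j ≡ j′
      index-injective n i {j} {j′} e = combine-injectiveˡ j i j′ i (toℕ-injective (begin
        toℕ (combine j i)     ≡⟨ toℕ-cast _ (combine j i) ⟨
        toℕ (index n i j)     ≡⟨ ≡.cong toℕ e ⟩
        toℕ (index n i j′)    ≡⟨ toℕ-cast _ (combine j′ i) ⟩
        toℕ (combine j′ i)    ∎))
        where open ≡-Reasoning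

      -- Modulo p^k, an entry of `T n` is an entry of `S` and leads, along `T n ∼ U`, to x, which is
      -- an entry of `parent`. Cycles joined by a path agree up to rotation.
      child∼⇒∼parent : ∃ (λ n → T n ∼ U) → S ∼ parent
      child∼⇒∼parent (n , Tn∼U) = reaches⇒∼ S parent {i₀} {iₓ}
        (Coarseⁱ.reaches-trans (0 , lifts n i₀ j₀) (Coarseⁱ.reaches-trans
          (coarsen-reaches (∼⇒reaches (T n) U Tn∼U (index n i₀ j₀) (0 mod length U)))
          (0 , Coarse.sym entry-parent≡x)))
        where
        i₀ = 0 mod length S
        j₀ = fromℕ< (1≤ratio n)

      -- If x lies above entry i of `S`, the p pairs (n , j) give child entries above that same
      -- entry. Their codes exhaust `Fin p`, so one of them is the code of x, whence `T n` and `U`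
      -- share an entry.
      ∼parent⇒child∼ : S ∼ parent → ∃ (λ n → T n ∼ U)
      ∼parent⇒child∼ S∼parent =
        let ((n , j) , e) = surjective (code (x , x≡entry))
        in  n , common-entry⇒∼ (T n) U {index n i j} {0 mod length U}
                  (code-injective (point (n , j)) (x , x≡entry) e)
        where
        reach : Coarseⁱ.Reaches (base S) x
        reach = Coarseⁱ.reaches-trans
          (∼⇒reaches S parent S∼parent (0 mod length S) iₓ)
          (0 , entry-parent≡x)

        i : Fin (length S)
        i = rotate (proj₁ reach) (0 mod length S)

        x≡entry : x ≡ entry S i [mod p ^ k ]
        x≡entry = Coarse.trans (Coarse.sym (proj₂ reach)) (iterate-entry S (proj₁ reach) (0 mod length S))

        open Lifts k (entry S i)

        Point : Set
        Point = Σ[ y ∈ PAdic p ] y ≡ entry S i [mod p ^ k ]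

        -- The new digit of y relative to `entry S i`; it determines y modulo p^(k+1).
        code : Point → Fin p
        code (y , y≡) = proj₁ (lift-covers y y≡)

        code-injective : ∀ u v → code u ≡ code v → proj₁ u ≡ proj₁ v [mod p ^ suc k ]
        code-injective (y , y≡) (z , z≡) e = Fine.trans (Fine.sym (proj₂ (lift-covers y y≡)))
          (Fine.trans (Fine.reflexive (≡.cong lift e)) (proj₂ (lift-covers z z≡)))

        point : Σ[ n ∈ Fin m ] Fin (ratio n) → Point
        point (n , j) = entry (T n) (index n i j) , Coarse.sym (lifts n i j)

        -- Equal codes give a common entry of two children, which are then the same child by
        -- `distinct`; within one child the entries are distinct.
        code-point-injective : Injective _≡_ _≡_ (code ∘ point)
        code-point-injective {n , j} {n′ , j′} e = same-child
          (distinct (common-entry⇒∼ (T n) (T n′) {index n i j} {index n′ i j′}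
            (code-injective (point (n , j)) (point (n′ , j′)) e))) e
          where
          same-child : ∀ {n n′ j j′} → n ≡ n′ → code (point (n , j)) ≡ code (point (n′ , j′)) →
                       _≡_ {A = Σ[ n ∈ Fin m ] Fin (ratio n)} (n , j) (n′ , j′)
          same-child {n} {j = j} {j′} refl e = ≡.cong (n ,_) (index-injective n i
            (entry-distinct (T n) (code-injective (point (n , j)) (point (n , j′)) e)))

        surjective : ∀ t → ∃ λ nj → code (point nj) ≡ t
        surjective = Σ-injective⇒surjective {f = ratio} {g = code ∘ point} (ℕ.≤-reflexive (≡.sym sum≡p))
          (λ {u} {v} → code-point-injective {u} {v})

      child∼⇔∼parent : ∃ (λ n → T n ∼ U) ⇔ S ∼ parent
      child∼⇔∼parent = mk⇔ child∼⇒∼parent ∼parent⇒child∼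

-- The second component contains both halves of the disjoint union: taking S′ = S shows that U is a
-- child of S, and any other cycle having U as a child is S up to rotation.
theorem3p22 : (p : ℕ) → 2 ≤ p → (π : PAdicPermutation p) (k : ℕ) →
    ((S : Cycle (induced π k)) →
    ∃[ m ] Σ[ T ∈ (Fin m → Cycle (induced π (suc k))) ] AreChildren π k S T)
    ×
    ((U : Cycle (induced π (suc k))) →
    Σ[ S ∈ Cycle (induced π k) ]
    ((S′ : Cycle (induced π k)) {m : ℕ} (T : Fin m → Cycle (induced π (suc k))) →
    AreChildren π k S′ T → ((∃[ n ] T n ∼ U) ⇔ (S′ ∼ S))))
-- Matching on `suc p` supplies the `NonZero` instance.
theorem3p22 (suc p) _ π k =
    (λ S → _ , Children.children π k S , Children.areChildren π k S)
  , (λ U → parent π k U , child∼⇔∼parent π k U)
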